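{- For integers $1\le r<n$, $$\mathrm{LE}(n)\cap\left(\frac{n!}{r+1},\,n!\right]=\left\{\frac{n!}{r!}\,\ell:\ \ell\in \mathrm{LE}(r)\cap\left(\frac{r!}{r+1},\,r!\right]\right\}.$$
   Context: All posets are finite. For a finite poset $P$, $\mathrm{ext}(P)$ denotes the number of linear extensions of $P$. For a positive integer $n$, $\mathrm{LE}(n)=\{\mathrm{ext}(P): P \text{ a poset with } |P|=n\}$. -}

module Defs where

open import Data.Fin as Fin using (Fin; finToFun)
open import Data.Fin.Properties using (_≟_; _≤?_; all?; any?)
open import Data.Integer using (+_)
open import Data.List using (allFin; filter; length)
open import Data.Nat as ℕ using (ℕ; NonZero; _!; _^_)
open import Data.Nat.Properties using (_!≢0)
open import Data.Product using (_×_; ∃-syntax)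
open import Data.Rational.Unnormalised as ℚᵘ using (ℚᵘ)
open import Function.Definitions using (Injective; Surjective; Bijective)
open import Function.Consequences.Propositional
  using (strictlySurjective⇒surjective; surjective⇒strictlySurjective)
open import Level using (0ℓ) renaming (suc to lsuc)
open import Relation.Binary.Core using (Rel)
open import Relation.Binary.PropositionalEquality using (_≡_)
open import Relation.Binary.Structures using (IsDecPartialOrder)
open import Relation.Nullary using (Dec)
open import Relation.Nullary.Decidable using (map′; _×-dec_; _→-dec_)
open import Relation.Unary using (Pred)

-- A poset with n elements, its ground set labelled by Fin n.  Classically every
-- order on a finite set is decidable; decidability is what makes ext computable.
record FinPoset (n : ℕ) : Set₁ where
  infix 4 _≼_
  field
    _≼_               : Rel (Fin n) 0ℓ
    isDecPartialOrder : IsDecPartialOrder _≡_ _≼_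
  open IsDecPartialOrder isDecPartialOrder public
    using (isPartialOrder)
    renaming (_≤?_ to _≼?_; refl to ≼-refl; trans to ≼-trans; antisym to ≼-antisym)

injective? : {n : ℕ} (f : Fin n → Fin n) → Dec (Injective _≡_ _≡_ f)
injective? f = map′ (λ h {x} {y} → h x y) (λ h x y → h {x} {y})
  (all? λ x → all? λ y → (f x ≟ f y) →-dec (x ≟ y))

surjective? : {n : ℕ} (f : Fin n → Fin n) → Dec (Surjective _≡_ _≡_ f)
surjective? f = map′ strictlySurjective⇒surjective surjective⇒strictlySurjective
  (all? λ y → any? λ x → f x ≟ y)

module _ {n : ℕ} (P : FinPoset n) where
  open FinPoset P

  IsLinearExtension : (Fin n → Fin n) → Set
  IsLinearExtension f =
    Bijective _≡_ _≡_ f × (∀ x y → x ≼ y → f x Fin.≤ f y)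

  isLinearExtension? : (f : Fin n → Fin n) → Dec (IsLinearExtension f)
  isLinearExtension? f = (injective? f ×-dec surjective? f)
    ×-dec (all? λ x → all? λ y → (x ≼? y) →-dec (f x ≤? f y))

  -- As i runs through Fin (n ^ n), finToFun i runs through the maps Fin n → Fin n,
  -- each occurring once up to pointwise equality.
  ext : ℕ
  ext = length (filter (λ i → isLinearExtension? (finToFun i)) (allFin (n ^ n)))

LE : ℕ → Pred ℕ (lsuc 0ℓ)
LE n m = ∃[ P ] ext {n} P ≡ m

-- The natural numbers in the half-open rational interval (a , b].
Ioc : ℚᵘ → ℚᵘ → Pred ℕ 0ℓ
Ioc a b m = (a ℚᵘ.< + m ℚᵘ./ 1) × (+ m ℚᵘ./ 1 ℚᵘ.≤ b)

_!/_ : (m d : ℕ) .{{_ : NonZero d}} → ℚᵘ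
m !/ d = + (m !) ℚᵘ./ d

-- n ! / r !; the truncated division is exact whenever r ≤ n.
factorialRatio : ℕ → ℕ → ℕ
factorialRatio n r = (n ! ℕ./ r !) {{r !≢0}}

{-# OPTIONS --safe #-}
module Submission where

-- Deleting an element i maps a linear extension f of an n-element poset P to the
-- position f i together with a linear extension of P − i, and this is injective.
-- If i is isolated, all n positions occur, so ext P = n · ext (P − i).  If i is
-- comparable to another element, the first or the last position is excluded, so
-- ext P ≤ (n − 1) · ext (P − i).
--
-- A poset without isolated elements satisfies n · ext P ≤ n!, by induction.  Either
-- some P − x again has no isolated elements, and the bound above applies, or every
-- x has a neighbour whose only neighbour is x.  In the second case there is a
-- two-element component {x , y}; exchanging x and y shows
-- 2 · ext P ≤ n (n − 1) · ext (P − x − y), and n ≤ 2 (n − 2) for n ≥ 4.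
--
-- So a poset with ext P > n! / (r + 1) and n > r has an isolated element, and
-- isolated elements can be removed until r elements are left.

open import Defs
open import Data.Empty using (⊥)
open import Data.Fin as Fin using (Fin; zero; suc; finToFun; funToFin; combine; remQuot; punchIn; punchOut)
open import Data.Fin.Permutation.Components using (transpose; transpose-inverse)
open import Data.Fin.Properties as Finₚ using (any?; all?)
open import Data.Integer as ℤ using (+_)
import Data.Integer.Properties as ℤₚ
open import Data.List using (List; allFin; filter; lookup)
open import Data.List.Membership.Propositional.Properties using (∈-lookup; ∈-filter⁺; ∈-filter⁻; ∈-allFin)
open import Data.List.Relation.Unary.All as All using ()
open import Data.List.Relation.Unary.AllPairs using (_∷_)
open import Data.List.Relation.Unary.Any as Any using ()
open import Data.List.Relation.Unary.Any.Properties using (lookup-index)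
open import Data.List.Relation.Unary.Unique.Propositional using (Unique)
open import Data.List.Relation.Unary.Unique.Propositional.Properties using (allFin⁺; filter⁺)
open import Data.Nat using (ℕ; zero; suc; _*_; _+_; _∸_; _^_; _!; _≤_; _<_; z≤n; s≤s; NonZero)
open import Data.Nat.DivMod using (m/n*n≡m)
open import Data.Nat.Divisibility using (m≤n⇒m!∣n!)
open import Data.Nat.Properties
open import Data.Nat.Tactic.RingSolver using (solve-∀)
open import Data.Product using (_×_; ∃; ∃-syntax; _,_; proj₁; proj₂; uncurry)
open import Data.Rational.Unnormalised using (*<*; *≤*)
open import Data.Sum using (_⊎_; inj₁; inj₂; swap)
open import Data.Unit using (⊤; tt)
open import Function using (_∘_; case_of_)
open import Function.Consequences.Propositional using (strictlySurjective⇒surjective)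
open import Function.Definitions using (Injective; StrictlySurjective)
open import Relation.Binary.PropositionalEquality using (_≡_; _≢_; _≗_; refl; sym; trans; cong; cong₂; subst; subst₂; isEquivalence; module ≡-Reasoning)
open import Relation.Nullary using (¬_; Dec; yes; no; contradiction)
open import Relation.Nullary.Decidable using (_×-dec_; _⊎-dec_; ¬?; dec-true; dec-false)
open import Relation.Unary using (_∈_; _∩_; _≐_)

open FinPoset using (_≼?_; ≼-refl; ≼-trans; ≼-antisym)

private
  variable
    m n : ℕ

_⟨_≼_⟩ : FinPoset n → Fin n → Fin n → Set
P ⟨ i ≼ j ⟩ = FinPoset._≼_ P i j

-- Maps between finite sets

lookup-injective : ∀ {A : Set} {xs : List A} → Unique xs → Injective _≡_ _≡_ (lookup xs)
lookup-injective (x∉ ∷ u) {zero}  {zero}  eq = refl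
lookup-injective (x∉ ∷ u) {zero}  {suc j} eq = contradiction eq (All.lookup x∉ (∈-lookup j))
lookup-injective (x∉ ∷ u) {suc i} {zero}  eq = contradiction (sym eq) (All.lookup x∉ (∈-lookup i))
lookup-injective (x∉ ∷ u) {suc i} {suc j} eq = cong suc (lookup-injective u eq)

funToFin-cong : {f g : Fin m → Fin n} → f ≗ g → funToFin f ≡ funToFin g
funToFin-cong {m = zero}  eq = refl
funToFin-cong {m = suc m} eq = cong₂ combine (eq zero) (funToFin-cong (eq ∘ suc))

finToFun-injective : {a b : Fin (n ^ m)} → finToFun {n} {m} a ≗ finToFun b → a ≡ b
finToFun-injective {n} {m} {a} {b} eq = begin
  a                               ≡⟨ Finₚ.funToFin-finToFin {m} {n} a ⟨
  funToFin (finToFun {n} {m} a)   ≡⟨ funToFin-cong eq ⟩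
  funToFin (finToFun {n} {m} b)   ≡⟨ Finₚ.funToFin-finToFin {m} {n} b ⟩
  b                               ∎
  where open ≡-Reasoning

remQuot-injective : ∀ k → Injective _≡_ _≡_ (remQuot {m} k)
remQuot-injective {m} k {a} {b} eq = begin
  a                               ≡⟨ Finₚ.combine-remQuot {m} k a ⟨
  uncurry combine (remQuot {m} k a)   ≡⟨ cong (uncurry (combine {m} {k})) eq ⟩
  uncurry combine (remQuot {m} k b)   ≡⟨ Finₚ.combine-remQuot {m} k b ⟩
  b                               ∎
  where open ≡-Reasoning

-- If a value `y` were missed, `punchOut` at `y` would inject `Fin (suc n)` into `Fin n`.
injective⇒surjective : {f : Fin n → Fin n} → Injective _≡_ _≡_ f → StrictlySurjective _≡_ f
injective⇒surjective {zero}          inj ()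
injective⇒surjective {suc n} {f} inj y with any? (λ x → f x Finₚ.≟ y)
... | yes x,fx≡y = x,fx≡y
... | no ∄x      = contradiction
  (Finₚ.injective⇒≤ λ {a} {b} eq → inj (Finₚ.punchOut-injective (y≢f a) (y≢f b) eq))
  1+n≰n
  where
  y≢f : ∀ x → y ≢ f x
  y≢f x eq = ∄x (x , sym eq)

injective-resp-≗ : {f g : Fin m → Fin n} → f ≗ g → Injective _≡_ _≡_ f → Injective _≡_ _≡_ g
injective-resp-≗ f≗g inj eq = inj (trans (f≗g _) (trans eq (sym (f≗g _))))

-- Matching on this view separates the deleted element `i` from the survivors, which appear in the
-- form that `delete P i` uses.
data PunchView (i : Fin (suc n)) : Fin (suc n) → Set where
  same  : PunchView i i
  other : ∀ j → PunchView i (punchIn i j)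

punchView : ∀ (i k : Fin (suc n)) → PunchView i k
punchView i k with i Finₚ.≟ k
... | yes refl = same
... | no i≢k   = subst (PunchView i) (Finₚ.punchIn-punchOut i≢k) (other (punchOut i≢k))

transpose-matchˡ : ∀ (i j : Fin n) → transpose i j i ≡ j
transpose-matchˡ i j rewrite dec-true (i Finₚ.≟ i) refl = refl

transpose-matchʳ : ∀ (i j : Fin n) → transpose i j j ≡ i
transpose-matchʳ i j with j Finₚ.≟ i
... | yes refl = refl
... | no _ rewrite dec-true (j Finₚ.≟ j) refl = refl

transpose-fixed : ∀ {i j k : Fin n} → k ≢ i → k ≢ j → transpose i j k ≡ k
transpose-fixed {i = i} {j} {k} k≢i k≢j
  rewrite dec-false (k Finₚ.≟ i) k≢i | dec-false (k Finₚ.≟ j) k≢j = refl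

transpose-injective : ∀ (i j : Fin n) → Injective _≡_ _≡_ (transpose i j)
transpose-injective i j {a} {b} eq =
  trans (sym (transpose-inverse j i)) (trans (cong (transpose j i) eq) (transpose-inverse j i))

-- Enumerating linear extensions

mkLinearExtension : (P : FinPoset n) {f : Fin n → Fin n} → Injective _≡_ _≡_ f →
  (∀ j k → P ⟨ j ≼ k ⟩ → f j Fin.≤ f k) → IsLinearExtension P f
mkLinearExtension P inj mono = (inj , strictlySurjective⇒surjective (injective⇒surjective inj)) , mono

abstract

  -- A copy of ext that conversion checking does not evaluate.
  count : FinPoset n → ℕ
  count = ext

  count≡ext : (P : FinPoset n) → count P ≡ ext P
  count≡ext P = refl

  count-empty : (P : FinPoset 0) → count P ≡ 1
  count-empty P = refl

module _ (P : FinPoset n) where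

  private
    isExt? : (a : Fin (n ^ n)) → Dec (IsLinearExtension P (finToFun a))
    isExt? a = isLinearExtension? P (finToFun a)

    exts : List (Fin (n ^ n))
    exts = filter isExt? (allFin (n ^ n))

  abstract
    -- `enum` and `index-of` identify `Fin (count P)` with the linear extensions of `P` up to
    -- pointwise equality. The counts below are compared through injections between `Fin` types.
    enum : Fin (count P) → Fin n → Fin n
    enum a = finToFun (lookup exts a)

    enum-isExt : ∀ a → IsLinearExtension P (enum a)
    enum-isExt a = proj₂ (∈-filter⁻ isExt? {xs = allFin (n ^ n)} (∈-lookup a))

    enum-injective : ∀ {a b} → enum a ≗ enum b → a ≡ b
    enum-injective eq = lookup-injective (filter⁺ isExt? (allFin⁺ (n ^ n))) (finToFun-injective eq)

    index-of : ∀ f → IsLinearExtension P f → ∃[ a ] enum a ≗ f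
    index-of f ((inj , _) , mono) = Any.index f∈ , λ x →
      trans (cong (λ a → finToFun a x) (sym (lookup-index f∈))) (Finₚ.finToFun-funToFin f x)
      where
      g≗f : finToFun (funToFin f) ≗ f
      g≗f = Finₚ.finToFun-funToFin f
      f∈ : Any.Any (funToFin f ≡_) exts
      f∈ = ∈-filter⁺ isExt? (∈-allFin (funToFin f))
        (mkLinearExtension P (injective-resp-≗ (sym ∘ g≗f) inj)
          λ j k j≼k → subst₂ Fin._≤_ (sym (g≗f j)) (sym (g≗f k)) (mono j k j≼k))

  code : ∀ f → IsLinearExtension P f → Fin (count P)
  code f e = proj₁ (index-of f e)

  code-injective : ∀ {f g} (e : IsLinearExtension P f) (e′ : IsLinearExtension P g) →
    code f e ≡ code g e′ → f ≗ g
  code-injective {f} {g} e e′ eq x = begin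
    f x                   ≡⟨ proj₂ (index-of f e) x ⟨
    enum (code f e) x     ≡⟨ cong (λ a → enum a x) eq ⟩
    enum (code g e′) x    ≡⟨ proj₂ (index-of g e′) x ⟩
    g x                   ∎
    where open ≡-Reasoning

ext-mono : (P Q : FinPoset n) → (∀ {f} → IsLinearExtension P f → IsLinearExtension Q f) → count P ≤ count Q
ext-mono P Q sub = Finₚ.injective⇒≤ λ {a} {b} eq →
  enum-injective P (code-injective Q (sub (enum-isExt P a)) (sub (enum-isExt P b)) eq)

-- Deleting an element

delete : FinPoset (suc n) → Fin (suc n) → FinPoset n
delete P i = record
  { _≼_ = λ j k → P ⟨ punchIn i j ≼ punchIn i k ⟩
  ; isDecPartialOrder = record
    { isPartialOrder = record
      { isPreorder = record
        { isEquivalence = isEquivalence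
        ; reflexive     = λ { refl → ≼-refl P }
        ; trans         = ≼-trans P
        }
      ; antisym = λ j≼k k≼j → Finₚ.punchIn-injective i _ _ (≼-antisym P j≼k k≼j)
      }
    ; _≟_  = Finₚ._≟_
    ; _≤?_ = λ j k → _≼?_ P (punchIn i j) (punchIn i k)
    }
  }

module _ (P : FinPoset (suc n)) (i : Fin (suc n)) where

  -- Relations that involve `i` are left out, so that restriction also applies to maps that violate
  -- the order at `i`, such as a linear extension composed with a transposition.
  MonotoneOff : (Fin (suc n) → Fin (suc n)) → Set
  MonotoneOff f = ∀ j k → P ⟨ punchIn i j ≼ punchIn i k ⟩ → f (punchIn i j) Fin.≤ f (punchIn i k)

  module _ {f : Fin (suc n) → Fin (suc n)} (inj : Injective _≡_ _≡_ f) (mono : MonotoneOff f) where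

    private
      fi≢ : ∀ j → f i ≢ f (punchIn i j)
      fi≢ j eq = Finₚ.punchInᵢ≢i i j (sym (inj eq))

    restrict : Fin n → Fin n
    restrict j = punchOut (fi≢ j)

    punchIn-restrict : ∀ j → punchIn (f i) (restrict j) ≡ f (punchIn i j)
    punchIn-restrict j = Finₚ.punchIn-punchOut (fi≢ j)

    restrict-isExt : IsLinearExtension (delete P i) restrict
    restrict-isExt = mkLinearExtension (delete P i)
      (λ {j} {k} eq → Finₚ.punchIn-injective i j k (inj (Finₚ.punchOut-injective (fi≢ j) (fi≢ k) eq)))
      (λ j k j≼k → Finₚ.punchOut-mono-≤ (fi≢ j) (fi≢ k) (mono j k j≼k))

    restrictCode : Fin (count (delete P i))
    restrictCode = code (delete P i) restrict restrict-isExt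

  -- The position `f i` and the restriction determine `f`, since `punchIn (f i)` undoes the
  -- `punchOut` in `restrict`.
  restrictCode-injective : ∀ {f g} (inj : Injective _≡_ _≡_ f) (mono : MonotoneOff f)
    (inj′ : Injective _≡_ _≡_ g) (mono′ : MonotoneOff g) →
    f i ≡ g i → restrictCode inj mono ≡ restrictCode inj′ mono′ → f ≗ g
  restrictCode-injective {f} {g} inj mono inj′ mono′ fi≡gi eq k with punchView i k
  ... | same    = fi≡gi
  ... | other j = begin
    f (punchIn i j)                          ≡⟨ punchIn-restrict inj mono j ⟨
    punchIn (f i) (restrict inj mono j)      ≡⟨ cong₂ punchIn fi≡gi (rs j) ⟩
    punchIn (g i) (restrict inj′ mono′ j)    ≡⟨ punchIn-restrict inj′ mono′ j ⟩
    g (punchIn i j)                          ∎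
    where
    open ≡-Reasoning
    rs : restrict inj mono ≗ restrict inj′ mono′
    rs = code-injective (delete P i) (restrict-isExt inj mono) (restrict-isExt inj′ mono′) eq

  module _ (a : Fin (count P)) where

    enum-inj : Injective _≡_ _≡_ (enum P a)
    enum-inj = proj₁ (proj₁ (enum-isExt P a))

    enum-mono : ∀ j k → P ⟨ j ≼ k ⟩ → enum P a j Fin.≤ enum P a k
    enum-mono = proj₂ (enum-isExt P a)

    enum-monoOff : MonotoneOff (enum P a)
    enum-monoOff j k = enum-mono (punchIn i j) (punchIn i k)

  ext≤suc*ext-delete : count P ≤ suc n * count (delete P i)
  ext≤suc*ext-delete = Finₚ.injective⇒≤ {f = φ} λ {a} {b} eq →
    let eq₁ , eq₂ = Finₚ.combine-injective (enum P a i) _ (enum P b i) _ eq in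
    enum-injective P (restrictCode-injective (enum-inj a) (enum-monoOff a) (enum-inj b) (enum-monoOff b) eq₁ eq₂)
    where
    φ : Fin (count P) → Fin (suc n * count (delete P i))
    φ a = combine (enum P a i) (restrictCode (enum-inj a) (enum-monoOff a))

  -- Punching the excluded position `p` out of the positions of `i` leaves `n` choices instead of
  -- `suc n`.
  ext-delete-excluded : ∀ p → (∀ a → p ≢ enum P a i) → count P ≤ n * count (delete P i)
  ext-delete-excluded p p≢ = Finₚ.injective⇒≤ {f = φ} λ {a} {b} eq →
    let eq₁ , eq₂ = Finₚ.combine-injective (punchOut (p≢ a)) _ (punchOut (p≢ b)) _ eq in
    enum-injective P (restrictCode-injective (enum-inj a) (enum-monoOff a) (enum-inj b) (enum-monoOff b)
      (Finₚ.punchOut-injective (p≢ a) (p≢ b) eq₁) eq₂)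
    where
    φ : Fin (count P) → Fin (n * count (delete P i))
    φ a = combine (punchOut (p≢ a)) (restrictCode (enum-inj a) (enum-monoOff a))

-- Isolated elements

module _ (P : FinPoset n) where

  Neighbour : Fin n → Fin n → Set
  Neighbour i j = i ≢ j × (P ⟨ i ≼ j ⟩ ⊎ P ⟨ j ≼ i ⟩)

  neighbour-sym : ∀ {i j} → Neighbour i j → Neighbour j i
  neighbour-sym (i≢j , c) = i≢j ∘ sym , swap c

  HasNeighbour : Fin n → Set
  HasNeighbour i = ∃ (Neighbour i)

  hasNeighbour? : ∀ i → Dec (HasNeighbour i)
  hasNeighbour? i = any? λ j → ¬? (i Finₚ.≟ j) ×-dec (_≼?_ P i j ⊎-dec _≼?_ P j i)

  NoIsolated : Set
  NoIsolated = ∀ i → HasNeighbour i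

  noIsolated? : NoIsolated ⊎ ∃[ i ] ¬ HasNeighbour i
  noIsolated? with all? hasNeighbour?
  ... | yes h = inj₁ h
  ... | no ¬h = inj₂ (Finₚ.¬∀⟶∃¬ n HasNeighbour hasNeighbour? ¬h)

neighbour-delete : (P : FinPoset (suc n)) {i : Fin (suc n)} {j k : Fin n} →
  Neighbour P (punchIn i j) (punchIn i k) → Neighbour (delete P i) j k
neighbour-delete P {i} (j≢k , c) = j≢k ∘ cong (punchIn i) , c

-- A neighbour other than `i` would survive the deletion of `i`.
isolated-delete : (P : FinPoset (suc n)) {i : Fin (suc n)} {j : Fin n} →
  ¬ HasNeighbour (delete P i) j → ∀ {k} → Neighbour P (punchIn i j) k → i ≡ k
isolated-delete P {i} ¬h {k} nb with punchView i k
... | same     = refl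
... | other k′ = contradiction (k′ , neighbour-delete P nb) ¬h

-- An element below another one never takes the top position, and an element above another one never
-- takes position zero.
ext-delete-neighbour : (P : FinPoset (suc n)) {i : Fin (suc n)} → HasNeighbour P i →
  count P ≤ n * count (delete P i)
ext-delete-neighbour P {i} (j , i≢j , inj₁ i≼j) = ext-delete-excluded P i (Fin.fromℕ _) λ a top≡fi →
  i≢j (enum-inj P i a (Finₚ.≤-antisym (enum-mono P i a i j i≼j)
    (subst (enum P a j Fin.≤_) top≡fi (Finₚ.≤fromℕ (enum P a j)))))
ext-delete-neighbour P {i} (j , i≢j , inj₂ j≼i) = ext-delete-excluded P i zero λ a 0≡fi →
  i≢j (enum-inj P i a (Finₚ.≤-antisym (subst (Fin._≤ enum P a j) 0≡fi z≤n) (enum-mono P i a j i j≼i)))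

-- Reverses the deletion: `i` goes to position `p`, and the values of `g` from `p` on move up by
-- one.
insert : Fin (suc n) → Fin (suc n) → (Fin n → Fin n) → Fin (suc n) → Fin (suc n)
insert i p g k with i Finₚ.≟ k
... | yes _  = p
... | no i≢k = punchIn p (g (punchOut i≢k))

insert-same : ∀ (i p : Fin (suc n)) g → insert i p g i ≡ p
insert-same i p g with i Finₚ.≟ i
... | yes _  = refl
... | no i≢i = contradiction refl i≢i

insert-other : ∀ (i p : Fin (suc n)) g j → insert i p g (punchIn i j) ≡ punchIn p (g j)
insert-other i p g j with i Finₚ.≟ punchIn i j
... | yes eq = contradiction (sym eq) (Finₚ.punchInᵢ≢i i j)
... | no _   = cong (punchIn p ∘ g) (trans (Finₚ.punchOut-cong i refl) (Finₚ.punchOut-punchIn i))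

insert-injective : ∀ (i p : Fin (suc n)) {g} → Injective _≡_ _≡_ g → Injective _≡_ _≡_ (insert i p g)
insert-injective i p {g} inj {k} {l} eq with punchView i k | punchView i l
... | same    | same     = refl
... | same    | other l′ = contradiction
  (trans (sym (insert-other i p g l′)) (trans (sym eq) (insert-same i p g))) (Finₚ.punchInᵢ≢i p (g l′))
... | other k′ | same    = contradiction
  (trans (sym (insert-other i p g k′)) (trans eq (insert-same i p g))) (Finₚ.punchInᵢ≢i p (g k′))
... | other k′ | other l′ = cong (punchIn i) (inj (Finₚ.punchIn-injective p (g k′) (g l′)
  (trans (sym (insert-other i p g k′)) (trans eq (insert-other i p g l′)))))

module _ (P : FinPoset (suc n)) {i : Fin (suc n)} (iso : ¬ HasNeighbour P i) where

  -- Isolation rules out every relation between `i` and another element, so no choice of `p` can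
  -- break monotonicity.
  insert-isExt : ∀ p {g} → IsLinearExtension (delete P i) g → IsLinearExtension P (insert i p g)
  insert-isExt p {g} ((inj , _) , mono) = mkLinearExtension P (insert-injective i p inj) monotone
    where
    monotone : ∀ k l → P ⟨ k ≼ l ⟩ → insert i p g k Fin.≤ insert i p g l
    monotone k l k≼l with punchView i k | punchView i l
    ... | same     | same     = Finₚ.≤-refl
    ... | same     | other l′ = contradiction (_ , Finₚ.punchInᵢ≢i i l′ ∘ sym , inj₁ k≼l) iso
    ... | other k′ | same     = contradiction (_ , Finₚ.punchInᵢ≢i i k′ ∘ sym , inj₂ k≼l) iso
    ... | other k′ | other l′ = subst₂ Fin._≤_ (sym (insert-other i p g k′)) (sym (insert-other i p g l′))
      (Finₚ.punchIn-mono-≤ p (g k′) (g l′) (mono k′ l′ k≼l))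

  -- The upper bound is the one for arbitrary elements. For the lower bound, distinct pairs of a
  -- position for `i` and an extension of the rest give distinct insertions.
  ext-delete-isolated : count P ≡ suc n * count (delete P i)
  ext-delete-isolated = ≤-antisym (ext≤suc*ext-delete P i)
    (Finₚ.injective⇒≤ {f = φ ∘ remQuot {suc n} Q#} λ {a} {b} eq →
      remQuot-injective {suc n} Q# (φ-injective {remQuot {suc n} Q# a} {remQuot {suc n} Q# b} eq))
    where
    Q = delete P i
    Q# = count Q
    φ : Fin (suc n) × Fin (count Q) → Fin (count P)
    φ (p , a) = code P (insert i p (enum Q a)) (insert-isExt p (enum-isExt Q a))
    φ-injective : ∀ {pa qb} → φ pa ≡ φ qb → pa ≡ qb
    φ-injective {p , a} {q , b} eq = cong₂ _,_ p≡q (enum-injective Q λ j →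
      Finₚ.punchIn-injective p _ _ (begin
        punchIn p (enum Q a j)                 ≡⟨ insert-other i p (enum Q a) j ⟨
        insert i p (enum Q a) (punchIn i j)    ≡⟨ same-insert (punchIn i j) ⟩
        insert i q (enum Q b) (punchIn i j)    ≡⟨ insert-other i q (enum Q b) j ⟩
        punchIn q (enum Q b j)                 ≡⟨ cong (λ t → punchIn t (enum Q b j)) p≡q ⟨
        punchIn p (enum Q b j)                 ∎))
      where
      open ≡-Reasoning
      same-insert : insert i p (enum Q a) ≗ insert i q (enum Q b)
      same-insert = code-injective P (insert-isExt p (enum-isExt Q a)) (insert-isExt q (enum-isExt Q b)) eq
      p≡q : p ≡ q
      p≡q = trans (sym (insert-same i p (enum Q a))) (trans (same-insert i) (insert-same i q (enum Q b)))

addIsolated : FinPoset n → FinPoset (suc n)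
addIsolated {n} P = record
  { _≼_ = _≼⁺_
  ; isDecPartialOrder = record
    { isPartialOrder = record
      { isPreorder = record
        { isEquivalence = isEquivalence
        ; reflexive     = λ { {i} refl → ≼⁺-refl i }
        ; trans         = λ {i} {j} {k} → ≼⁺-trans i j k
        }
      ; antisym = λ {i} {j} → ≼⁺-antisym i j
      }
    ; _≟_  = Finₚ._≟_
    ; _≤?_ = _≼⁺?_
    }
  }
  where
  _≼⁺_ : Fin (suc n) → Fin (suc n) → Set
  zero  ≼⁺ zero  = ⊤
  zero  ≼⁺ suc j = ⊥
  suc i ≼⁺ zero  = ⊥
  suc i ≼⁺ suc j = P ⟨ i ≼ j ⟩

  ≼⁺-refl : ∀ i → i ≼⁺ i
  ≼⁺-refl zero    = tt
  ≼⁺-refl (suc i) = ≼-refl P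

  ≼⁺-trans : ∀ i j k → i ≼⁺ j → j ≼⁺ k → i ≼⁺ k
  ≼⁺-trans zero    zero    zero    _   _   = tt
  ≼⁺-trans (suc i) (suc j) (suc k) i≼j j≼k = ≼-trans P i≼j j≼k

  ≼⁺-antisym : ∀ i j → i ≼⁺ j → j ≼⁺ i → i ≡ j
  ≼⁺-antisym zero    zero    _   _   = refl
  ≼⁺-antisym (suc i) (suc j) i≼j j≼i = cong suc (≼-antisym P i≼j j≼i)

  _≼⁺?_ : ∀ i j → Dec (i ≼⁺ j)
  zero  ≼⁺? zero  = yes tt
  zero  ≼⁺? suc j = no λ ()
  suc i ≼⁺? zero  = no λ ()
  suc i ≼⁺? suc j = _≼?_ P i j

ext-addIsolated : (P : FinPoset n) → count (addIsolated P) ≡ suc n * count P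
ext-addIsolated {n} P = trans (ext-delete-isolated (addIsolated P) zero-isolated)
  -- Both posets have the same relation but different proof fields; linear extensions see only the
  -- relation, so each count bounds the other.
  (cong (suc n *_) (≤-antisym (ext-mono (delete (addIsolated P) zero) P λ e → e)
                              (ext-mono P (delete (addIsolated P) zero) λ e → e)))
  where
  zero-isolated : ¬ HasNeighbour (addIsolated P) zero
  zero-isolated (zero  , 0≢0 , _)     = 0≢0 refl
  zero-isolated (suc j , _ , inj₁ ())
  zero-isolated (suc j , _ , inj₂ ())

-- Upper bounds on the number of linear extensions

ext≤! : ∀ n (P : FinPoset n) → count P ≤ n !
ext≤! zero    P = ≤-reflexive (count-empty P)
ext≤! (suc n) P = ≤-trans (ext≤suc*ext-delete P zero) (*-monoʳ-≤ (suc n) (ext≤! n (delete P zero)))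

-- Exchanging the positions of x and y gives a second map that is monotone off x.
2*ext-delete-pendant : (P : FinPoset (suc n)) {x : Fin (suc n)} {y′ : Fin n} →
  Neighbour P x (punchIn x y′) → ¬ HasNeighbour (delete P x) y′ →
  2 * count P ≤ suc n * count (delete P x)
2*ext-delete-pendant {n} P {x} {y′} (x≢y , x~y) iso =
  Finₚ.injective⇒≤ {f = uncurry φ ∘ remQuot {2} (count P)} λ {a} {b} eq →
    remQuot-injective {2} (count P) (φ-injective {remQuot {2} (count P) a} {remQuot {2} (count P) b} eq)
  where
  Q = delete P x
  y = punchIn x y′

  τ : Fin 2 → Fin (suc n) → Fin (suc n)
  τ zero       = λ k → k
  τ (suc zero) = transpose x y

  move : Fin 2 → Fin (count P) → Fin (suc n) → Fin (suc n)
  move b a = enum P a ∘ τ b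

  τ-injective : ∀ b → Injective _≡_ _≡_ (τ b)
  τ-injective zero       = λ eq → eq
  τ-injective (suc zero) = transpose-injective x y

  move-injective : ∀ b a → Injective _≡_ _≡_ (move b a)
  move-injective b a = τ-injective b ∘ enum-inj P x a

  move-mono : ∀ b a → MonotoneOff P x (move b a)
  move-mono zero       a j k j≼k = enum-monoOff P x a j k j≼k
  -- As `y′` is isolated in `Q`, the only relation off `x` that involves `y` is reflexivity. The
  -- transposition fixes the elements other than `x` and `y`.
  move-mono (suc zero) a j k j≼k with j Finₚ.≟ y′ | k Finₚ.≟ y′
  ... | yes refl | yes refl = Finₚ.≤-refl
  ... | yes refl | no k≢y   = contradiction (k , k≢y ∘ sym , inj₁ j≼k) iso
  ... | no j≢y   | yes refl = contradiction (j , j≢y ∘ sym , inj₂ j≼k) iso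
  ... | no j≢y   | no k≢y   = subst₂ Fin._≤_ (fixed j j≢y) (fixed k k≢y) (enum-monoOff P x a j k j≼k)
    where
    fixed : ∀ l → l ≢ y′ → enum P a (punchIn x l) ≡ move (suc zero) a (punchIn x l)
    fixed l l≢y = cong (enum P a)
      (sym (transpose-fixed (Finₚ.punchInᵢ≢i x l) (l≢y ∘ Finₚ.punchIn-injective x l y′)))

  -- One map places `x` and `y` in the order of `P`, the other in reverse; equal maps would put both
  -- at the same position.
  opposite-orders : ∀ a b → ¬ (enum P a ≗ move (suc zero) b)
  opposite-orders a b eq = x≢y (enum-inj P x a (case x~y of λ where
      (inj₁ x≼y) → Finₚ.≤-antisym (enum-mono P x a x y x≼y)
                     (subst₂ Fin._≤_ (sym ay) (sym ax) (enum-mono P x b x y x≼y))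
      (inj₂ y≼x) → Finₚ.≤-antisym (subst₂ Fin._≤_ (sym ax) (sym ay) (enum-mono P x b y x y≼x))
                     (enum-mono P x a y x y≼x)))
    where
    ax : enum P a x ≡ enum P b y
    ax = trans (eq x) (cong (enum P b) (transpose-matchˡ x y))
    ay : enum P a y ≡ enum P b x
    ay = trans (eq y) (cong (enum P b) (transpose-matchʳ x y))

  φ : Fin 2 → Fin (count P) → Fin (suc n * count Q)
  φ b a = combine (move b a x) (restrictCode P x (move-injective b a) (move-mono b a))

  φ⇒move : ∀ b a b′ a′ → φ b a ≡ φ b′ a′ → move b a ≗ move b′ a′
  φ⇒move b a b′ a′ eq =
    let eq₁ , eq₂ = Finₚ.combine-injective (move b a x) _ (move b′ a′ x) _ eq in
    restrictCode-injective P x (move-injective b a) (move-mono b a) (move-injective b′ a′) (move-mono b′ a′) eq₁ eq₂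

  φ-injective : Injective _≡_ _≡_ (uncurry φ)
  φ-injective {zero     , a} {zero     , b} eq = cong (zero ,_) (enum-injective P (φ⇒move zero a zero b eq))
  φ-injective {zero     , a} {suc zero , b} eq = contradiction (φ⇒move zero a (suc zero) b eq) (opposite-orders a b)
  φ-injective {suc zero , a} {zero     , b} eq =
    contradiction (sym ∘ φ⇒move (suc zero) a zero b eq) (opposite-orders b a)
  -- Evaluating at `transpose y x k` cancels the transposition.
  φ-injective {suc zero , a} {suc zero , b} eq = cong (suc zero ,_) (enum-injective P λ k →
    subst (λ l → enum P a l ≡ enum P b l) (transpose-inverse x y)
      (φ⇒move (suc zero) a (suc zero) b eq (transpose y x k)))

-- Posets without isolated elements

halve-bound : ∀ a b c e q E F → a ≤ 2 * c → 2 * e ≤ a * q → q ≤ b * E → c * E ≤ F → a * e ≤ a * (b * F)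
halve-bound a b c e q E F a≤2c 2e≤aq q≤bE cE≤F = *-monoʳ-≤ a (*-cancelˡ-≤ 2 (begin
  2 * e                ≤⟨ 2e≤aq ⟩
  a * q                ≤⟨ *-mono-≤ a≤2c q≤bE ⟩
  2 * c * (b * E)      ≡⟨ rearrange b c E ⟩
  2 * (b * (c * E))    ≤⟨ *-monoʳ-≤ 2 (*-monoʳ-≤ b cE≤F) ⟩
  2 * (b * F)          ∎))
  where
  open ≤-Reasoning
  rearrange : ∀ b c E → 2 * c * (b * E) ≡ 2 * (b * (c * E))
  rearrange = solve-∀

4+k≤2[2+k] : ∀ k → 4 + k ≤ 2 * (2 + k)
4+k≤2[2+k] k = subst (4 + k ≤_) (rearrange k) (m≤m+n (4 + k) k)
  where
  rearrange : ∀ k → 4 + k + k ≡ 2 * (2 + k)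
  rearrange = solve-∀

ext-delete-component : ∀ n (P : FinPoset (suc (suc n))) {x y′} →
  Neighbour P x (punchIn x y′) → ¬ HasNeighbour (delete P x) y′ →
  NoIsolated (delete (delete P x) y′) →
  n * count (delete (delete P x) y′) ≤ n ! →
  suc (suc n) * count P ≤ suc (suc n) !
-- Posets with two or three elements are treated apart, since there the size exceeds twice the size
-- minus two.
ext-delete-component zero P {x} {y′} xy iso _ _ = begin
  2 * count P                              ≤⟨ 2*ext-delete-pendant P xy iso ⟩
  2 * count (delete P x)                   ≤⟨ *-monoʳ-≤ 2 (ext≤! 1 (delete P x)) ⟩
  2                                      ∎
  where open ≤-Reasoning
-- The single element left after removing the component would be isolated.
ext-delete-component (suc zero) P xy iso noIso _ with noIso zero
... | zero , 0≢0 , _ = contradiction refl 0≢0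
ext-delete-component (suc (suc k)) P {x} {y′} xy iso _ ih =
  -- With N = 4 + k elements, the first three arguments are N, N - 1 and N - 2. The gain of 2 from
  -- the exchange offsets N ≤ 2 (N - 2), and the factor N - 2 is the one in the induction
  -- hypothesis.
  halve-bound (4 + k) (3 + k) (2 + k) (count P) (count (delete P x)) (count (delete (delete P x) y′)) ((2 + k) !)
    (4+k≤2[2+k] k) (2*ext-delete-pendant P xy iso) (ext≤suc*ext-delete (delete P x) y′) ih

module _ (P : FinPoset (suc (suc n))) (noIso : NoIsolated P)
         (pendant : ∀ z → ∃[ w ] ¬ HasNeighbour (delete P z) w)
         (x : Fin (suc (suc n))) {y′ : Fin (suc n)} (y′-iso : ¬ HasNeighbour (delete P x) y′) where

  private
    y = punchIn x y′

    y-only : ∀ {z} → Neighbour P y z → x ≡ z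
    y-only = isolated-delete P y′-iso

  -- `y` has some neighbour but becomes isolated once `x` is deleted, so that neighbour is `x`.
  pendant-neighbour : Neighbour P x y
  pendant-neighbour with noIso y
  ... | z , y~z with refl ← y-only y~z = neighbour-sym P y~z

  private
    -- An element w whose only neighbour is y must be x.
    x-only : ∀ {z} → Neighbour P x z → y ≡ z
    x-only x~z with pendant y
    ... | w′ , w′-iso with noIso (punchIn y w′)
    ...   | u , w~u with refl ← isolated-delete P w′-iso w~u =
      isolated-delete P w′-iso (subst (λ t → Neighbour P t _) (y-only (neighbour-sym P w~u)) x~z)

  -- `x` and `y` are each other's only neighbours, so removing both takes no neighbour away from any
  -- other element.
  noIsolated-delete-component : NoIsolated (delete (delete P x) y′)
  noIsolated-delete-component k with noIso (punchIn x (punchIn y′ k))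
  ... | z , k~z with punchView x z
  ...   | same = contradiction (Finₚ.punchIn-injective x _ _ (sym (x-only (neighbour-sym P k~z))))
                               (Finₚ.punchInᵢ≢i y′ k)
  ...   | other z′ with punchView y′ z′
  ...     | same     = contradiction (sym (y-only (neighbour-sym P k~z))) (Finₚ.punchInᵢ≢i x (punchIn y′ k))
  ...     | other z″ = z″ , neighbour-delete (delete P x) (neighbour-delete P k~z)

-- For positive `n` this is the bound (n - 1)! on the count; the factor `n` lets the statement cover
-- `n` = 0 as well.
NoIsolatedBound : ℕ → Set₁
NoIsolatedBound n = (P : FinPoset n) → NoIsolated P → n * count P ≤ n !

noIsolatedBound-step : ∀ n → NoIsolatedBound n → NoIsolatedBound (suc n) → NoIsolatedBound (suc (suc n))
noIsolatedBound-step n ih₀ ih₁ P noIso with any? (λ x → all? (hasNeighbour? (delete P x)))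
... | yes (x , noIso′) = *-monoʳ-≤ (suc (suc n)) (≤-trans (ext-delete-neighbour P (noIso x)) (ih₁ (delete P x) noIso′))
-- Every deletion now leaves an isolated element, so the starting element `zero` is an arbitrary
-- choice.
... | no ∄x = bound (pendant zero)
  where
  pendant : ∀ z → ∃[ w ] ¬ HasNeighbour (delete P z) w
  pendant z = Finₚ.¬∀⟶∃¬ (suc n) (HasNeighbour (delete P z)) (hasNeighbour? (delete P z)) (λ h → ∄x (z , h))

  bound : ∃[ w ] ¬ HasNeighbour (delete P zero) w → suc (suc n) * count P ≤ suc (suc n) !
  bound (y′ , y′-iso) = ext-delete-component n P (pendant-neighbour P noIso pendant zero y′-iso) y′-iso noIso″
    (ih₀ (delete (delete P zero) y′) noIso″)
    where noIso″ = noIsolated-delete-component P noIso pendant zero y′-iso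

noIsolated⇒ext-bound : ∀ n → NoIsolatedBound n
noIsolated⇒ext-bound zero          P noIso = z≤n
noIsolated⇒ext-bound (suc zero)    P noIso with noIso zero
... | zero , 0≢0 , _ = contradiction refl 0≢0
noIsolated⇒ext-bound (suc (suc n)) =
  noIsolatedBound-step n (noIsolated⇒ext-bound n) (noIsolated⇒ext-bound (suc n))

-- Adding and removing isolated elements

-- Each removal of an isolated element divides the count by the current size, and these sizes
-- multiply to (d + r)! / r!. The equation is cross-multiplied to stay free of division.
shrink : ∀ d {r} (P : FinPoset (d + r)) → (d + r) ! < count P * suc r →
  ∃[ Q ] count P * r ! ≡ (d + r) ! * count {r} Q
shrink zero    {r} P _   = P , *-comm (count P) (r !)
shrink (suc d) {r} P big with noIsolated? P
-- Without isolated elements the count is at most n!/n for n = `suc (d + r)`, and n is at least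
-- `suc r`.
... | inj₁ noIso = contradiction big (≤⇒≯ (begin
  count P * suc r            ≤⟨ *-monoʳ-≤ (count P) (s≤s (m≤n+m r d)) ⟩
  count P * suc (d + r)      ≡⟨ *-comm (count P) _ ⟩
  suc (d + r) * count P      ≤⟨ noIsolated⇒ext-bound (suc (d + r)) P noIso ⟩
  suc (d + r) !            ∎))
  where open ≤-Reasoning
... | inj₂ (i , iso) = proj₁ rec , (begin
  count P * r !                              ≡⟨ cong (_* r !) eqP ⟩
  suc (d + r) * count P′ * r !               ≡⟨ *-assoc (suc (d + r)) (count P′) (r !) ⟩
  suc (d + r) * (count P′ * r !)             ≡⟨ cong (suc (d + r) *_) (proj₂ rec) ⟩
  suc (d + r) * ((d + r) ! * count (proj₁ rec))   ≡⟨ *-assoc (suc (d + r)) ((d + r) !) _ ⟨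
  suc (d + r) ! * count (proj₁ rec)          ∎)
  where
  open ≡-Reasoning
  P′ = delete P i
  eqP : count P ≡ suc (d + r) * count P′
  eqP = ext-delete-isolated P iso
  -- The hypothesis passes to `P′` because both of its sides carry the factor `suc (d + r)`.
  rec = shrink d P′ (*-cancelˡ-< (suc (d + r)) _ _
    (subst (suc (d + r) ! <_) (trans (cong (_* suc r) eqP) (*-assoc (suc (d + r)) (count P′) (suc r))) big))

grow : ∀ d {r} (Q : FinPoset r) → ∃[ P ] count {d + r} P * r ! ≡ (d + r) ! * count Q
grow zero    {r} Q = Q , *-comm (count Q) (r !)
grow (suc d) {r} Q with grow d Q
... | P , eq = addIsolated P , (begin
  count (addIsolated P) * r !             ≡⟨ cong (_* r !) (ext-addIsolated P) ⟩
  suc (d + r) * count P * r !             ≡⟨ *-assoc (suc (d + r)) (count P) (r !) ⟩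
  suc (d + r) * (count P * r !)           ≡⟨ cong (suc (d + r) *_) eq ⟩
  suc (d + r) * ((d + r) ! * count Q)     ≡⟨ *-assoc (suc (d + r)) ((d + r) !) _ ⟨
  suc (d + r) ! * count Q                 ∎)
  where open ≡-Reasoning

-- Rational intervals and the quotient n!/r!

count∈LE : (P : FinPoset n) → count P ∈ LE n
count∈LE P = P , sym (count≡ext P)

LE⇒count : m ∈ LE n → ∃[ P ] count {n} P ≡ m
LE⇒count (P , refl) = P , count≡ext P

-- The order on unnormalised rationals is cross-multiplied, so the lower endpoint condition unfolds
-- to `N ! * 1 < m * suc r` over the integers.
Ioc-lower : ∀ N r {b m} → m ∈ Ioc (N !/ suc r) b → N ! < m * suc r
Ioc-lower N r {m = m} (*<* lt , _) = ℤₚ.drop‿+<+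
  (subst₂ ℤ._<_ (ℤₚ.*-identityʳ (+ (N !))) (sym (ℤₚ.pos-* m (suc r))) lt)

Ioc-intro : ∀ N r {m} → N ! < m * suc r → m ≤ N ! → m ∈ Ioc (N !/ suc r) (N !/ 1)
Ioc-intro N r {m} lt le =
    *<* (subst₂ ℤ._<_ (sym (ℤₚ.*-identityʳ (+ (N !)))) (ℤₚ.pos-* m (suc r)) (ℤ.+<+ lt))
  , *≤* (ℤₚ.*-monoʳ-≤-nonNeg (+ 1) (ℤ.+≤+ le))

module _ {n r : ℕ} (r≤n : r ≤ n) where

  private
    c = factorialRatio n r
    instance
      r!≢0 : NonZero (r !)
      r!≢0 = r !≢0
      n!≢0 : NonZero (n !)
      n!≢0 = n !≢0

  factorialRatio-* : c * r ! ≡ n !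
  factorialRatio-* = m/n*n≡m (m≤n⇒m!∣n! r≤n)

  factorialRatio-cross : ∀ {a b} → a * r ! ≡ n ! * b → a ≡ c * b
  factorialRatio-cross {a} {b} eq = *-cancelʳ-≡ a (c * b) (r !) (begin
    a * r !          ≡⟨ eq ⟩
    n ! * b          ≡⟨ cong (_* b) factorialRatio-* ⟨
    c * r ! * b      ≡⟨ *-assoc c (r !) b ⟩
    c * (r ! * b)    ≡⟨ cong (c *_) (*-comm (r !) b) ⟩
    c * (b * r !)    ≡⟨ *-assoc c b (r !) ⟨
    c * b * r !      ∎)
    where open ≡-Reasoning

  -- Since n! = `c` · r!, dividing by `c` carries the threshold n!/s to r!/s; it is applied with `s`
  -- = `suc r`.
  factorialRatio-cancel-< : ∀ {b s} → n ! < c * b * s → r ! < b * s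
  factorialRatio-cancel-< {b} {s} lt =
    *-cancelˡ-< c _ _ (subst₂ _<_ (sym factorialRatio-*) (*-assoc c b s) lt)

  factorialRatio-mono-< : ∀ {b s} → r ! < b * s → n ! < c * b * s
  factorialRatio-mono-< {b} {s} lt = subst₂ _<_ factorialRatio-* (sym (*-assoc c b s))
    -- `c` is nonzero because it divides n!, which is nonzero.
    (*-monoʳ-< c {{m*n≢0⇒m≢0 c {{subst NonZero (sym factorialRatio-*) n!≢0}}}} lt)

theorem6p3 : (n r : ℕ) → 1 ≤ r → r < n →
    (LE n ∩ Ioc (n !/ suc r) (n !/ 1))
    ≐ (λ m → ∃[ ℓ ] (ℓ ∈ LE r ∩ Ioc (r !/ suc r) (r !/ 1)) × (m ≡ factorialRatio n r * ℓ))
-- Matching on the last equation replaces `n` by `d + r`, the form in which `shrink` and `grow`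
-- recurse on `d`.
theorem6p3 n r _ r<n with r≤n ← <⇒≤ r<n | n ∸ r | m∸n+n≡m (<⇒≤ r<n)
... | d | refl = to , from
  where
  to : ∀ {m} → m ∈ LE n ∩ Ioc (n !/ suc r) (n !/ 1) →
    ∃[ ℓ ] (ℓ ∈ LE r ∩ Ioc (r !/ suc r) (r !/ 1)) × (m ≡ factorialRatio n r * ℓ)
  to (m∈LE , m∈Ioc) with P , refl ← LE⇒count m∈LE
    with big ← Ioc-lower n r m∈Ioc
    with Q , eq ← shrink d P big =
    let m≡cℓ = factorialRatio-cross r≤n eq in
    count Q
    , ( count∈LE Q
      , Ioc-intro r r (factorialRatio-cancel-< r≤n (subst (λ t → n ! < t * suc r) m≡cℓ big)) (ext≤! r Q))
    , m≡cℓ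
  from : ∀ {m} → ∃[ ℓ ] (ℓ ∈ LE r ∩ Ioc (r !/ suc r) (r !/ 1)) × (m ≡ factorialRatio n r * ℓ) →
    m ∈ LE n ∩ Ioc (n !/ suc r) (n !/ 1)
  from (_ , (ℓ∈LE , ℓ∈Ioc) , refl) with Q , refl ← LE⇒count ℓ∈LE
    with P , eq ← grow d Q =
    let m≡cℓ = factorialRatio-cross r≤n eq in
    subst (_∈ LE n) m≡cℓ (count∈LE P)
    , Ioc-intro n r (factorialRatio-mono-< r≤n (Ioc-lower r r ℓ∈Ioc)) (subst (_≤ n !) m≡cℓ (ext≤! n P))
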